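{- Let $m,n\ge0$ be integers. The number of $(m,n)$-singletons, i.e. of binary $m$-painted $n$-trees $\mathbb{T}$ such that no other binary $m$-painted $n$-tree has the same shadow as $\mathbb{T}$, is $$m!\sum_{k=0}^{n}\binom{m+k-1}{k}\,\mathsf{Fib}_{n-k+1},$$ where $\mathsf{Fib}_k$ denotes the $k$-th Fibonacci number, with $\mathsf{Fib}_0=0$, $\mathsf{Fib}_1=1$ and $\mathsf{Fib}_{k+2}=\mathsf{Fib}_{k+1}+\mathsf{Fib}_k$ (and, for $m=0$, $\binom{ -1}{0}=1$ and $\binom{k-1}{k}=0$ for $k\ge1$).
   Context: Write $[k]=\{1,\dots,k\}$. **Painted trees.** An $n$-tree is a rooted plane tree with $n+1$ leaves, drawn growing downward from its root; "node" means internal node (leaves excluded), and unary nodes are allowed. A cut of an $n$-tree $T$ is a set of nodes of $T$ containing exactly one node on the path from the root to each leaf. A cut $c$ is below a cut $c'$ if, along any path from the root to a leaf, the node of $c$ is (strictly) after the node of $c'$. An $m$-painted $n$-tree $\mathbb{T}=(T,C,\mu)$ is an $n$-tree $T$ with a sequence $C=(c_1,\dots,c_k)$ of cuts of $T$, with $c_i$ below $c_{i+1}$ for all $i\in[k-1]$, such that $\bigcup C=c_1\cup\dots\cup c_k$ contains all unary nodes of $T$, and an ordered partition $\mu=(\mu_1,\dots,\mu_k)$ of $[m]$ into $k$ nonempty parts ($1\le k\le m$, or $k=0$ if $m=0$); $\mu_i$ is the label of $c_i$. It is binary if $k=m$, all nodes in $\bigcup C$ are unary and all nodes not in $\bigcup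 C$ are binary. **Shadow.** The right branch of $T$ is the path from the root to the rightmost leaf. The shadow $\mathrm{Sh}(\mathbb{T})$ of $\mathbb{T}=(T,C,\mu)$ is the pair of sequences indexed by the nodes of the right branch from the root downward, whose $i$-th terms are respectively the tuple $(n_1,\dots,n_{p-1})$, where $n_1,\dots,n_p$ are the numbers of leaves of the subtrees, from left to right, of the $i$-th node of the right branch, and the label of the cut of $C$ containing this node ($\varnothing$ if there is none). -}

module Defs where

open import Data.Bool.Base using (Bool; T; if_then_else_)
open import Data.Fin.Base using (Fin; fromℕ)
open import Data.Fin.Subset using (Subset; Nonempty) renaming (_∈_ to _∈ˢ_; ⊥ to ∅)
open import Data.List.Base using (List; []; _∷_; map; length)
open import Data.List.Membership.Propositional using (_∈_)
open import Data.List.Relation.Unary.Unique.Propositional using (Unique)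
open import Data.Nat.Base using (ℕ; suc; _+_)
open import Data.Product.Base using (∃; _×_; _,_; proj₁; proj₂)
open import Data.Product using (∃!)
open import Data.Vec.Base as Vec using (Vec; []; _∷_)
open import Data.Vec.Relation.Unary.All using (All)
open import Data.Vec.Relation.Unary.All.Properties using (lookup⁺)
open import Data.Vec.Relation.Unary.Linked using (Linked)
open import Function.Bundles using (_⇔_)
open import Relation.Binary.PropositionalEquality.Core using (_≡_)
open import Relation.Nullary.Negation.Core using (¬_)

fib : ℕ → ℕ
fib 0             = 0
fib 1             = 1
fib (suc (suc k)) = fib (suc k) + fib k

-- Rooted plane trees; an internal node has at least one child.

data Tree : Set where
  leaf : Tree
  node : ∀ {p} → Vec Tree (suc p) → Tree

mutual
  leaves : Tree → ℕ
  leaves leaf      = 1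
  leaves (node ts) = leavesSum ts

  leavesSum : ∀ {p} → Vec Tree p → ℕ
  leavesSum []       = 0
  leavesSum (t ∷ ts) = leaves t + leavesSum ts

-- Internal nodes and leaves of a tree, given by their position in it.

data Node : Tree → Set where
  root  : ∀ {p} {ts : Vec Tree (suc p)} → Node (node ts)
  child : ∀ {p} {ts : Vec Tree (suc p)} (i : Fin (suc p)) →
          Node (Vec.lookup ts i) → Node (node ts)

data Leaf : Tree → Set where
  here  : Leaf leaf
  child : ∀ {p} {ts : Vec Tree (suc p)} (i : Fin (suc p)) →
          Leaf (Vec.lookup ts i) → Leaf (node ts)

-- v StrictlyAfter w: v is a proper descendant of w.
data _StrictlyAfter_ : ∀ {t} → Node t → Node t → Set where
  root  : ∀ {p} {ts : Vec Tree (suc p)} {i : Fin (suc p)}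
          {v : Node (Vec.lookup ts i)} →
          child {ts = ts} i v StrictlyAfter root
  child : ∀ {p} {ts : Vec Tree (suc p)} {i : Fin (suc p)}
          {v w : Node (Vec.lookup ts i)} →
          v StrictlyAfter w → child {ts = ts} i v StrictlyAfter child i w

-- The nodes on the path to a leaf, from the root downward.
path : ∀ {t} → Leaf t → List (Node t)
path here        = []
path (child i ℓ) = root ∷ map (child i) (path ℓ)

subtrees : ∀ {t} → Node t → ∃ λ p → Vec Tree (suc p)
subtrees (root {ts = ts}) = _ , ts
subtrees (child i v)      = subtrees v

arity : ∀ {t} → Node t → ℕ
arity v = suc (proj₁ (subtrees v))

-- Sets of nodes are Boolean markings of the nodes, stored in the shape of the
-- tree, so that two sets with the same elements are propositionally equal.

data NodeSet : Tree → Set where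
  leaf : NodeSet leaf
  node : ∀ {p} {ts : Vec Tree (suc p)} → Bool → All NodeSet ts → NodeSet (node ts)

marked : ∀ {t} → NodeSet t → Node t → Bool
marked (node b cs) root        = b
marked (node b cs) (child i v) = marked (lookup⁺ cs i) v

infix 4 _∈ᴺ_

_∈ᴺ_ : ∀ {t} → Node t → NodeSet t → Set
v ∈ᴺ c = T (marked c v)

IsCut : ∀ {t} → NodeSet t → Set
IsCut {t} c = ∀ (ℓ : Leaf t) → ∃! _≡_ λ v → v ∈ path ℓ × v ∈ᴺ c

Below : ∀ {t} → NodeSet t → NodeSet t → Set
Below {t} c c′ = ∀ (ℓ : Leaf t) {v v′ : Node t} → v ∈ path ℓ → v′ ∈ path ℓ →
                 v ∈ᴺ c → v′ ∈ᴺ c′ → v StrictlyAfter v′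

IsOrderedPartition : ∀ {m k} → Vec (Subset m) k → Set
IsOrderedPartition {m} {k} μ =
  (∀ (i : Fin k) → Nonempty (Vec.lookup μ i)) ×
  (∀ (x : Fin m) → ∃! _≡_ λ (i : Fin k) → x ∈ˢ Vec.lookup μ i)

-- The data (T, C, μ) is kept apart from the conditions on it, so that equality
-- of painted trees is propositional equality of the data and does not involve
-- the proofs of these conditions.

record PaintedData (m : ℕ) : Set where
  constructor painted
  field
    tree   : Tree
    k      : ℕ
    cuts   : Vec (NodeSet tree) k
    labels : Vec (Subset m) k

module _ {m : ℕ} (𝕋 : PaintedData m) where
  open PaintedData 𝕋

  InSomeCut : Node tree → Set
  InSomeCut v = ∃ λ (i : Fin k) → v ∈ᴺ Vec.lookup cuts i

  -- The bounds relating k and m follow from the ordered partition.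
  record IsPainted (n : ℕ) : Set where
    field
      leaves≡1+n       : leaves tree ≡ suc n
      areCuts          : ∀ (i : Fin k) → IsCut (Vec.lookup cuts i)
      below            : Linked Below cuts
      unary⇒inCut      : ∀ (v : Node tree) → arity v ≡ 1 → InSomeCut v
      orderedPartition : IsOrderedPartition labels

  record IsBinary : Set where
    field
      k≡m             : k ≡ m
      inCut⇒unary     : ∀ (v : Node tree) → InSomeCut v → arity v ≡ 1
      notInCut⇒binary : ∀ (v : Node tree) → ¬ InSomeCut v → arity v ≡ 2

mutual
  rightmostLeaf : (t : Tree) → Leaf t
  rightmostLeaf leaf      = here
  rightmostLeaf (node ts) = child (fromℕ _) (rightmostLeafOfLast ts)

  rightmostLeafOfLast : ∀ {p} (ts : Vec Tree (suc p)) → Leaf (Vec.lookup ts (fromℕ p))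
  rightmostLeafOfLast (t ∷ [])     = rightmostLeaf t
  rightmostLeafOfLast (_ ∷ u ∷ us) = rightmostLeafOfLast (u ∷ us)

rightBranch : (t : Tree) → List (Node t)
rightBranch t = path (rightmostLeaf t)

leafCounts : ∀ {t} → Node t → List ℕ
leafCounts v = Vec.toList (Vec.map leaves (Vec.init (proj₂ (subtrees v))))

-- In a painted tree a node lies in at most one cut, so taking the first cut
-- that contains it involves no choice.
label : ∀ {t m k} → Vec (NodeSet t) k → Vec (Subset m) k → Node t → Subset m
label []       []       v = ∅
label (c ∷ cs) (M ∷ Ms) v = if marked c v then M else label cs Ms v

Shadow : ∀ {m} → PaintedData m → List (List ℕ) × List (Subset m)
Shadow (painted t _ C μ) = map leafCounts (rightBranch t) , map (label C μ) (rightBranch t)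

IsBinaryPaintedTree : (m n : ℕ) → PaintedData m → Set
IsBinaryPaintedTree m n 𝕋 = IsPainted 𝕋 n × IsBinary 𝕋

IsSingleton : (m n : ℕ) → PaintedData m → Set
IsSingleton m n 𝕋 =
  IsBinaryPaintedTree m n 𝕋 ×
  (∀ 𝕋′ → IsBinaryPaintedTree m n 𝕋′ → Shadow 𝕋′ ≡ Shadow 𝕋 → 𝕋′ ≡ 𝕋)

-- Exactly N elements satisfy P.
HasCardinality : {A : Set} → (A → Set) → ℕ → Set
HasCardinality {A} P N =
  ∃ λ (xs : List A) → Unique xs × (∀ x → x ∈ xs ⇔ P x) × length xs ≡ N

{-# OPTIONS --safe #-}
module Submission where

-- Every left subtree hanging off the right branch has leaf count and number r of
-- cuts crossing it fixed by the shadow, and can be replaced freely by any other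
-- subtree with these data. Such a subtree is unique exactly when it has one leaf, or
-- when it has two leaves and r = 0. Hence a singleton amounts to an ordering of
-- the m labels, a distribution of k one-leaf left subtrees among the m gaps
-- above the lowest cut, and a composition of n - k into parts 1 and 2 below it.
-- Splitting off the topmost node gives the recurrence
-- S(r+1, n+1) = S(r, n+1) + S(r+1, n), which is Pascal's rule for the sum.

open import Defs
open import Data.Bool.Base using (Bool; true; false; T; if_then_else_)
open import Data.Bool.Properties using (T?)
open import Data.Empty using (⊥-elim)
open import Data.Fin.Base using (Fin; zero; suc; toℕ; fromℕ<; punchIn; punchOut)
open import Data.Fin.Properties as Fin
  using (toℕ<n; toℕ-fromℕ<; punchIn-injective; punchInᵢ≢i; punchIn-punchOut; punchOut-injective; _≟_)
open import Data.Fin.Subset using (Subset; ⁅_⁆) renaming (_∈_ to _∈ˢ_; ⊥ to ∅)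
open import Data.Fin.Subset.Properties using (x∈⁅x⁆; x∈⁅y⁆⇒x≡y; ⊆-antisym)
open import Data.List.Base using
  (List; []; _∷_; _++_; map; sum; upTo; applyUpTo; length; cartesianProductWith; allFin)
open import Data.List.Membership.Propositional using (_∈_)
open import Data.List.Membership.Propositional.Properties using
  (∈-map⁺; ∈-map⁻; ∈-++⁺ˡ; ∈-++⁺ʳ; ∈-++⁻; ∈-allFin; ∈-cartesianProductWith⁺; ∈-cartesianProductWith⁻)
open import Data.List.Properties using
  (map-∘; map-cong; map-upTo; length-map; length-++; length-tabulate; ∷-injectiveˡ; ∷-injectiveʳ)
open import Data.List.Relation.Binary.Disjoint.Propositional using (Disjoint)
open import Data.List.Relation.Unary.All using ([])
open import Data.List.Relation.Unary.Any using (here; there)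
open import Data.List.Relation.Unary.Unique.Propositional using (Unique; []; _∷_)
import Data.List.Relation.Unary.Unique.Propositional.Properties as Unique
open import Data.Nat.Base using
  (ℕ; zero; suc; _+_; _∸_; _*_; _!; _≤_; _<_; z≤n; s≤s; s≤s⁻¹; _≡ᵇ_)
open import Data.Nat.Combinatorics using (_C_; k>n⇒nCk≡0; nCk+nC[k+1]≡[n+1]C[k+1])
open import Data.Nat.Properties using
  ( suc-injective; +-assoc; +-comm; +-identityʳ; +-suc; *-comm; *-identityˡ; *-distribʳ-+; m≢1+m+n
  ; ≡ᵇ⇒≡; ≡⇒≡ᵇ; <⇒≢; >⇒≢; <⇒≤; ≰⇒>; ≤-refl; ≤-trans; n≤1+n; n<1+n; m≤n⇒m<n∨m≡n; _≤?_)
open import Data.Nat.Solver using (module +-*-Solver)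
open +-*-Solver using (solve; _:+_; _:=_)
open import Data.Product.Base using (Σ; ∃; ∃₂; _×_; _,_; proj₁; proj₂)
open import Data.Product using (∃!)
open import Data.Sum.Base using (_⊎_; inj₁; inj₂)
open import Data.Vec.Base as Vec using (Vec; []; _∷_)
open import Data.Vec.Properties as Vec using (lookup∘tabulate; tabulate∘lookup; tabulate-cong; lookup-map)
open import Data.Vec.Relation.Unary.All using (All; []; _∷_)
open import Data.Vec.Relation.Unary.All.Properties using (lookup⁺)
open import Data.Vec.Relation.Unary.Linked using (Linked; []; [-]; _∷_)
open import Function.Base using (_∘_; id)
open import Function.Bundles using (mk⇔)
open import Relation.Binary.PropositionalEquality using (_≡_; _≢_; refl; sym; trans; cong; cong₂; subst)
open import Relation.Nullary using (¬_; yes; no)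

-- Cuts and restriction to the children of the root

-- A functional counterpart of `NodeSet`: restriction to the i-th child becomes composition with
-- `child i`, so no set has to be rebuilt.
Marking : Tree → Set
Marking t = Node t → Bool

infix 4 _∈ᴹ_

_∈ᴹ_ : ∀ {t} → Node t → Marking t → Set
v ∈ᴹ p = T (p v)

IsCutᴹ : ∀ {t} → Marking t → Set
IsCutᴹ {t} p = ∀ (ℓ : Leaf t) → ∃! _≡_ λ v → v ∈ path ℓ × v ∈ᴹ p

Belowᴹ : ∀ {t} → Marking t → Marking t → Set
Belowᴹ {t} p q = ∀ (ℓ : Leaf t) {v v′ : Node t} → v ∈ path ℓ → v′ ∈ path ℓ →
                 v ∈ᴹ p → v′ ∈ᴹ q → v StrictlyAfter v′

child-path⁺ : ∀ {p} {ts : Vec Tree (suc p)} {i} {ℓ : Leaf (Vec.lookup ts i)} {v} →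
              v ∈ path ℓ → child {ts = ts} i v ∈ path (child {ts = ts} i ℓ)
child-path⁺ v∈ = there (∈-map⁺ (child _) v∈)

∈path-cases : ∀ {p} {ts : Vec Tree (suc p)} {i} {ℓ : Leaf (Vec.lookup ts i)} {v : Node (node ts)} →
              v ∈ path (child {ts = ts} i ℓ) → v ≡ root ⊎ ∃ λ w → w ∈ path ℓ × v ≡ child i w
∈path-cases (here v≡root) = inj₁ v≡root
∈path-cases (there v∈)    = inj₂ (∈-map⁻ (child _) v∈)

child-after⁻ : ∀ {p} {ts : Vec Tree (suc p)} {i} {v w : Node (Vec.lookup ts i)} →
               child {ts = ts} i v StrictlyAfter child i w → v StrictlyAfter w
child-after⁻ (child v>w) = v>w

somePathThrough : ∀ {t} (v : Node t) → ∃ λ (ℓ : Leaf t) → v ∈ path ℓ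
somePathThrough (root {ts = ts}) = rightmostLeaf (node ts) , here refl
somePathThrough (child i v) with somePathThrough v
... | ℓ , v∈ = child i ℓ , child-path⁺ v∈

module _ {q} {ts : Vec Tree (suc q)} {p : Marking (node ts)} where

  isCut-root⁺ : root ∈ᴹ p → (∀ i v → ¬ child i v ∈ᴹ p) → IsCutᴹ p
  isCut-root⁺ r∈ ∉p (child i ℓ) = root , (here refl , r∈) , unique
    where
    unique : ∀ {v} → v ∈ path (child i ℓ) × v ∈ᴹ p → root ≡ v
    unique (v∈ , v∈p) with ∈path-cases v∈
    ... | inj₁ refl           = refl
    ... | inj₂ (w , _ , refl) = ⊥-elim (∉p i w v∈p)

  isCut-root⁻ : IsCutᴹ p → root ∈ᴹ p → ∀ i v → ¬ child i v ∈ᴹ p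
  isCut-root⁻ cut r∈ i v v∈ with somePathThrough v
  ... | ℓ , v∈ℓ with cut (child i ℓ)
  ... | _ , _ , unique with trans (sym (unique (here refl , r∈))) (unique (child-path⁺ v∈ℓ , v∈))
  ... | ()

  isCut-child⁺ : ¬ root ∈ᴹ p → (∀ i → IsCutᴹ (p ∘ child i)) → IsCutᴹ p
  isCut-child⁺ r∉ cut (child i ℓ) with cut i ℓ
  ... | w , (w∈ , w∈p) , unique = child i w , (child-path⁺ w∈ , w∈p) , unique′
    where
    unique′ : ∀ {v} → v ∈ path (child i ℓ) × v ∈ᴹ p → child i w ≡ v
    unique′ (v∈ , v∈p) with ∈path-cases v∈
    ... | inj₁ refl             = ⊥-elim (r∉ v∈p)
    ... | inj₂ (v′ , v′∈ , refl) = cong (child i) (unique (v′∈ , v∈p))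

  isCut-child⁻ : ¬ root ∈ᴹ p → IsCutᴹ p → ∀ i → IsCutᴹ (p ∘ child i)
  isCut-child⁻ r∉ cut i ℓ with cut (child i ℓ)
  ... | v , (v∈ , v∈p) , unique with ∈path-cases v∈
  ... | inj₁ refl            = ⊥-elim (r∉ v∈p)
  ... | inj₂ (w , w∈ , refl) = w , (w∈ , v∈p) ,
    λ (w′∈ , w′∈p) → child-injective (unique (child-path⁺ w′∈ , w′∈p))
    where
    child-injective : ∀ {w′} → child {ts = ts} i w ≡ child i w′ → w ≡ w′
    child-injective refl = refl

module _ {q} {ts : Vec Tree (suc q)} {p p′ : Marking (node ts)} where

  below-child⁺ : ¬ root ∈ᴹ p → (∀ i → Belowᴹ (p ∘ child i) (p′ ∘ child i)) → Belowᴹ p p′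
  below-child⁺ r∉ below (child i ℓ) v∈ v′∈ v∈p v′∈p′ with ∈path-cases v∈ | ∈path-cases v′∈
  ... | inj₁ refl            | _                      = ⊥-elim (r∉ v∈p)
  ... | inj₂ (_ , _ , refl)  | inj₁ refl              = root
  ... | inj₂ (_ , w∈ , refl) | inj₂ (_ , w′∈ , refl) = child (below i ℓ w∈ w′∈ v∈p v′∈p′)

  below-child⁻ : Belowᴹ p p′ → ∀ i → Belowᴹ (p ∘ child i) (p′ ∘ child i)
  below-child⁻ below i ℓ v∈ v′∈ v∈p v′∈p′ =
    child-after⁻ (below (child i ℓ) (child-path⁺ v∈) (child-path⁺ v′∈) v∈p v′∈p′)

  -- Every path carries a node of the cut `p′`. A root in `p` would have to come strictly after that
  -- node, but the root comes strictly after nothing.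
  below⇒root∉ : Belowᴹ p p′ → IsCutᴹ p′ → ¬ root ∈ᴹ p
  below⇒root∉ below cut′ r∈ with rightmostLeaf (node ts)
  ... | child i ℓ with cut′ (child i ℓ)
  ... | v , (v∈ , v∈p′) , _ with below (child i ℓ) (here refl) v∈ r∈ v∈p′
  ... | ()

-- Binary paintings and their restrictions

-- The conditions on a binary painted tree, in terms of the family of markings
-- f 0, …, f (r ∸ 1) from the lowest cut to the highest, continued by empty
-- markings. Restricting f to the child of a unary root shifts nothing: the
-- highest cut merely becomes empty.
record IsBinaryPainting {t} (r : ℕ) (f : ℕ → Marking t) : Set where
  field
    areCuts         : ∀ i → i < r → IsCutᴹ (f i)
    below           : ∀ i → suc i < r → Belowᴹ (f i) (f (suc i))
    empty           : ∀ i → r ≤ i → ∀ v → ¬ v ∈ᴹ f i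
    unary⇒inCut     : ∀ v → arity v ≡ 1 → ∃ λ i → v ∈ᴹ f i
    inCut⇒unary     : ∀ i v → v ∈ᴹ f i → arity v ≡ 1
    notInCut⇒binary : ∀ v → (∀ i → ¬ v ∈ᴹ f i) → arity v ≡ 2

module _ {q} {ts : Vec Tree (suc q)} {f : ℕ → Marking (node ts)} where

  -- Were i not the highest index, `f i` would lie below the cut `f (suc i)` and could not contain
  -- the root.
  root∈⇒highest : ∀ {r} → IsBinaryPainting r f → ∀ {i} → root ∈ᴹ f i → suc i ≡ r
  root∈⇒highest {r} P {i} r∈ with r ≤? i
  ... | yes r≤i = ⊥-elim (empty i r≤i root r∈)
    where open IsBinaryPainting P
  ... | no r≰i with m≤n⇒m<n∨m≡n (≰⇒> r≰i)
  ...   | inj₂ eq    = eq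
  ...   | inj₁ 1+i<r = ⊥-elim (below⇒root∉ (below i 1+i<r) (areCuts (suc i) 1+i<r) r∈)
    where open IsBinaryPainting P

  -- One Boolean test decides this: the highest cut is the only one that can contain the root.
  rootInCut? : ∀ {r} → IsBinaryPainting r f →
               (∃ λ r′ → r ≡ suc r′ × root ∈ᴹ f r′) ⊎ (∀ i → ¬ root ∈ᴹ f i)
  rootInCut? {zero} P = inj₂ λ i r∈ → 0≢suc (root∈⇒highest P r∈)
    where
    0≢suc : ∀ {n} → suc n ≢ 0
    0≢suc ()
  rootInCut? {suc r′} P with T? (f r′ root)
  ... | yes r∈ = inj₁ (r′ , refl , r∈)
  ... | no r∉  = inj₂ λ i r∈ → r∉ (subst (λ j → root ∈ᴹ f j) (suc-injective (root∈⇒highest P r∈)) r∈)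

  restrict-root∉ : ∀ {r} → IsBinaryPainting r f → (∀ i → ¬ root ∈ᴹ f i) →
                   ∀ i → IsBinaryPainting r (λ j → f j ∘ child i)
  restrict-root∉ P r∉ i = record
    { areCuts         = λ j j<r → isCut-child⁻ (r∉ j) (areCuts j j<r) i
    ; below           = λ j 1+j<r → below-child⁻ (below j 1+j<r) i
    ; empty           = λ j r≤j v → empty j r≤j (child i v)
    ; unary⇒inCut     = λ v → unary⇒inCut (child i v)
    ; inCut⇒unary     = λ j v → inCut⇒unary j (child i v)
    ; notInCut⇒binary = λ v → notInCut⇒binary (child i v)
    }
    where open IsBinaryPainting P

  restrict-root∈ : ∀ {r} → IsBinaryPainting (suc r) f → root ∈ᴹ f r →
                   ∀ i → IsBinaryPainting r (λ j → f j ∘ child i)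
  restrict-root∈ {r} P r∈ i = record
    { areCuts         = λ j j<r → isCut-child⁻ (λ r∈′ → <⇒≢ j<r (suc-injective (root∈⇒highest P r∈′)))
                                               (areCuts j (≤-trans j<r (n≤1+n r))) i
    ; below           = λ j 1+j<r → below-child⁻ (below j (≤-trans 1+j<r (n≤1+n r))) i
    ; empty           = empty′
    ; unary⇒inCut     = λ v → unary⇒inCut (child i v)
    ; inCut⇒unary     = λ j v → inCut⇒unary j (child i v)
    ; notInCut⇒binary = λ v → notInCut⇒binary (child i v)
    }
    where
    open IsBinaryPainting P
    empty′ : ∀ j → r ≤ j → ∀ v → ¬ child i v ∈ᴹ f j
    empty′ j r≤j v v∈ with m≤n⇒m<n∨m≡n r≤j
    ... | inj₁ r<j  = empty j r<j (child i v) v∈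
    -- The highest cut consists of the root alone, so index r becomes empty on the child.
    ... | inj₂ refl = isCut-root⁻ (areCuts r ≤-refl) r∈ i v v∈

-- Cut trees and the decomposition of binary paintings

-- CutTree r: binary trees crossed by r cuts; the constructor cut adds a unary
-- root forming the highest cut.
data CutTree : ℕ → Set where
  leaf : CutTree 0
  cut  : ∀ {r} → CutTree r → CutTree (suc r)
  bin  : ∀ {r} → CutTree r → CutTree r → CutTree r

tree : ∀ {r} → CutTree r → Tree
tree leaf      = leaf
tree (cut b)   = node (tree b ∷ [])
tree (bin a b) = node (tree a ∷ tree b ∷ [])

-- Cuts are numbered from the lowest, so the unary root above a tree with r cuts gets number r and
-- the numbers below it do not change. The index is any natural number; from r onwards the set is
-- empty.
cutAt : ∀ {r} (b : CutTree r) → ℕ → NodeSet (tree b)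
cutAt leaf        i = leaf
cutAt (cut {r} b) i = node (i ≡ᵇ r) (cutAt b i ∷ [])
cutAt (bin a b)   i = node false (cutAt a i ∷ cutAt b i ∷ [])

-- The `cut` constructors are exactly the unary nodes, so the bare plane tree already records where
-- the cuts pass.
tree-injective : ∀ {r} (b b′ : CutTree r) → tree b ≡ tree b′ → b ≡ b′
tree-injective leaf      leaf        _  = refl
tree-injective leaf      (bin _ _)   ()
tree-injective (cut b)   (cut b′)    eq = cong cut (tree-injective b b′ (onlyChild eq))
  where
  onlyChild : ∀ {t t′} → Tree.node (t ∷ []) ≡ node (t′ ∷ []) → t ≡ t′
  onlyChild refl = refl
tree-injective (cut _)   (bin _ _)   ()
tree-injective (bin _ _) leaf        ()
tree-injective (bin _ _) (cut _)     ()
tree-injective (bin a b) (bin a′ b′) eq =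
  cong₂ bin (tree-injective a a′ (proj₁ (children eq))) (tree-injective b b′ (proj₂ (children eq)))
  where
  children : ∀ {s t s′ t′} → Tree.node (s ∷ t ∷ []) ≡ node (s′ ∷ t′ ∷ []) → s ≡ s′ × t ≡ t′
  children refl = refl , refl

cutAt-empty : ∀ {r} (b : CutTree r) i → r ≤ i → ∀ v → ¬ v ∈ᴺ cutAt b i
cutAt-empty (cut {r} b) i r<i root             v∈ = >⇒≢ r<i (≡ᵇ⇒≡ i r v∈)
cutAt-empty (cut b)     i r<i (child zero v)   v∈ = cutAt-empty b i (<⇒≤ r<i) v v∈
cutAt-empty (bin a b)   i r≤i (child zero v)   v∈ = cutAt-empty a i r≤i v v∈
cutAt-empty (bin a b)   i r≤i (child (suc zero) v) v∈ = cutAt-empty b i r≤i v v∈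

isBinaryPainting : ∀ {r} (b : CutTree r) → IsBinaryPainting r (λ i → marked (cutAt b i))
isBinaryPainting leaf = record
  { areCuts         = λ _ ()
  ; below           = λ _ ()
  ; empty           = λ _ _ ()
  ; unary⇒inCut     = λ ()
  ; inCut⇒unary     = λ _ ()
  ; notInCut⇒binary = λ ()
  }
isBinaryPainting (cut {r} b) = record
  { areCuts         = areCuts′
  ; below           = below′
  ; empty           = cutAt-empty (cut b)
  ; unary⇒inCut     = λ { root _ → r , ≡⇒≡ᵇ r r refl ; (child zero v) → unary⇒inCut v }
  ; inCut⇒unary     = λ { _ root _ → refl ; i (child zero v) → inCut⇒unary i v }
  ; notInCut⇒binary = λ { root r∉ → ⊥-elim (r∉ r (≡⇒≡ᵇ r r refl)) ; (child zero v) → notInCut⇒binary v }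
  }
  where
  open IsBinaryPainting (isBinaryPainting b)
  root∉ : ∀ {i} → i < r → ¬ root ∈ᴺ cutAt (cut b) i
  root∉ i<r r∈ = <⇒≢ i<r (≡ᵇ⇒≡ _ r r∈)
  areCuts′ : ∀ i → i < suc r → IsCut (cutAt (cut b) i)
  areCuts′ i i<1+r with m≤n⇒m<n∨m≡n (s≤s⁻¹ i<1+r)
  ... | inj₁ i<r  = isCut-child⁺ (root∉ i<r) λ { zero → areCuts i i<r ; (suc ()) }
  ... | inj₂ refl = isCut-root⁺ (≡⇒≡ᵇ r r refl) λ { zero v → cutAt-empty b r ≤-refl v ; (suc ()) }
  below′ : ∀ i → suc i < suc r → Below (cutAt (cut b) i) (cutAt (cut b) (suc i))
  below′ i 1+i<1+r with m≤n⇒m<n∨m≡n (s≤s⁻¹ 1+i<1+r)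
  ... | inj₁ 1+i<r = below-child⁺ (root∉ (s≤s⁻¹ 1+i<1+r)) λ { zero → below i 1+i<r ; (suc ()) }
  -- The upper of the two cuts is now the new root alone. It contains no node of the child, so there
  -- is nothing to compare there.
  ... | inj₂ refl  = below-child⁺ (root∉ (s≤s⁻¹ 1+i<1+r))
    λ { zero ℓ _ _ _ v′∈ → ⊥-elim (cutAt-empty b r ≤-refl _ v′∈) ; (suc ()) }
isBinaryPainting (bin a b) = record
  { areCuts         = λ i i<r → isCut-child⁺ (λ ()) λ { zero → A.areCuts i i<r ; (suc zero) → B.areCuts i i<r }
  ; below           = λ i 1+i<r → below-child⁺ (λ ()) λ { zero → A.below i 1+i<r ; (suc zero) → B.below i 1+i<r }
  ; empty           = cutAt-empty (bin a b)
  ; unary⇒inCut     = λ { (child zero v) → A.unary⇒inCut v ; (child (suc zero) v) → B.unary⇒inCut v }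
  ; inCut⇒unary     = λ { i (child zero v) → A.inCut⇒unary i v ; i (child (suc zero) v) → B.inCut⇒unary i v }
  ; notInCut⇒binary = λ { root _ → refl ; (child zero v) → A.notInCut⇒binary v
                        ; (child (suc zero) v) → B.notInCut⇒binary v }
  }
  where
  module A = IsBinaryPainting (isBinaryPainting a)
  module B = IsBinaryPainting (isBinaryPainting b)

T-ext : ∀ {x y} → (T x → T y) → (T y → T x) → x ≡ y
T-ext {false} {false} _ _ = refl
T-ext {false} {true}  _ g = ⊥-elim (g _)
T-ext {true}  {false} f _ = ⊥-elim (f _)
T-ext {true}  {true}  _ _ = refl

¬T⇒≡false : ∀ {x} → ¬ T x → false ≡ x
¬T⇒≡false ¬x = T-ext (λ ()) ¬x

-- Induction on the tree: a root in some cut is unary and gives `cut`, a root in no cut is binary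
-- and gives `bin`, and every other arity contradicts one of these two conditions. The children
-- carry the restricted paintings.
decompose : ∀ t {r} (f : ℕ → Marking t) → IsBinaryPainting r f →
            ∃ λ (b : CutTree r) → Σ (tree b ≡ t) λ eq →
            ∀ i v → marked (cutAt b i) v ≡ f i (subst Node eq v)
decompose leaf {zero}  f P = leaf , refl , λ _ ()
-- A cut would need a node on the path to the leaf, and this path is empty.
decompose leaf {suc r} f P with IsBinaryPainting.areCuts P 0 (s≤s z≤n) here
... | _ , (() , _) , _
decompose (node (t ∷ [])) f P with rootInCut? P
... | inj₂ r∉ with IsBinaryPainting.notInCut⇒binary P root r∉
...   | ()
decompose (node (t ∷ [])) f P | inj₁ (r , refl , r∈)
  with decompose t (λ i → f i ∘ child zero) (restrict-root∈ P r∈ zero)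
... | b , refl , eq = cut b , refl , λ where
  i root           → T-ext (λ i≡r → subst (λ j → root ∈ᴹ f j) (sym (≡ᵇ⇒≡ i r i≡r)) r∈)
                           (λ r∈′ → ≡⇒≡ᵇ i r (suc-injective (root∈⇒highest P r∈′)))
  i (child zero v) → eq i v
decompose (node (s ∷ t ∷ [])) f P with rootInCut? P
... | inj₁ (r , refl , r∈) with IsBinaryPainting.inCut⇒unary P r root r∈
...   | ()
decompose (node (s ∷ t ∷ [])) f P | inj₂ r∉
  with decompose s (λ i → f i ∘ child zero) (restrict-root∉ P r∉ zero)
     | decompose t (λ i → f i ∘ child (suc zero)) (restrict-root∉ P r∉ (suc zero))
... | a , refl , eqₐ | b , refl , eqᵦ = bin a b , refl , λ where
  i root                 → ¬T⇒≡false (r∉ i)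
  i (child zero v)       → eqₐ i v
  i (child (suc zero) v) → eqᵦ i v
decompose (node (_ ∷ _ ∷ _ ∷ _)) f P with rootInCut? P
... | inj₁ (r , _ , r∈) with IsBinaryPainting.inCut⇒unary P r root r∈
...   | ()
decompose (node (_ ∷ _ ∷ _ ∷ _)) f P | inj₂ r∉ with IsBinaryPainting.notInCut⇒binary P root r∉
...   | ()

-- Binary painted trees as labelled cut trees

-- Indices past the end give the empty marking, which is the continuation that `IsBinaryPainting`
-- expects.
markedAt : ∀ {t k} → Vec (NodeSet t) k → ℕ → Marking t
markedAt []       _       _ = false
markedAt (c ∷ cs) zero      = marked c
markedAt (c ∷ cs) (suc i)   = markedAt cs i

markedAt-lookup : ∀ {t k} (cs : Vec (NodeSet t) k) i → marked (Vec.lookup cs i) ≡ markedAt cs (toℕ i)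
markedAt-lookup (c ∷ cs) zero    = refl
markedAt-lookup (c ∷ cs) (suc i) = markedAt-lookup cs i

markedAt-fromℕ< : ∀ {t k} (cs : Vec (NodeSet t) k) {i} (i<k : i < k) →
                  marked (Vec.lookup cs (fromℕ< i<k)) ≡ markedAt cs i
markedAt-fromℕ< cs i<k = trans (markedAt-lookup cs (fromℕ< i<k)) (cong (markedAt cs) (toℕ-fromℕ< i<k))

markedAt-empty : ∀ {t k} (cs : Vec (NodeSet t) k) i → k ≤ i → ∀ v → ¬ v ∈ᴹ markedAt cs i
markedAt-empty (c ∷ cs) (suc i) k≤i = markedAt-empty cs i (s≤s⁻¹ k≤i)

∈markedAt⇒< : ∀ {t k} (cs : Vec (NodeSet t) k) i {v} → v ∈ᴹ markedAt cs i → i < k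
∈markedAt⇒< (c ∷ cs) zero    v∈ = s≤s z≤n
∈markedAt⇒< (c ∷ cs) (suc i) v∈ = s≤s (∈markedAt⇒< cs i v∈)

below-markedAt : ∀ {t k} {cs : Vec (NodeSet t) k} → Linked Below cs →
                 ∀ i → suc i < k → Belowᴹ (markedAt cs i) (markedAt cs (suc i))
below-markedAt [-] i (s≤s ())
below-markedAt {cs = _ ∷ _ ∷ _} (b ∷ bs) zero    _       = b
below-markedAt {cs = _ ∷ _ ∷ _} (b ∷ bs) (suc i) 1+i<k = below-markedAt bs i (s≤s⁻¹ 1+i<k)

linked-tabulate : ∀ {t} k (c : ℕ → NodeSet t) → (∀ i → suc i < k → Below (c i) (c (suc i))) →
                  Linked Below (Vec.tabulate {n = k} (c ∘ toℕ))
linked-tabulate zero          c below = []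
linked-tabulate (suc zero)    c below = [-]
linked-tabulate (suc (suc k)) c below =
  below 0 (s≤s (s≤s z≤n)) ∷ linked-tabulate (suc k) (c ∘ suc) (λ i i<k → below (suc i) (s≤s i<k))

mutual
  nodeSet-ext : ∀ {t} {c c′ : NodeSet t} → (∀ v → marked c v ≡ marked c′ v) → c ≡ c′
  nodeSet-ext {c = leaf}      {leaf}        _  = refl
  nodeSet-ext {c = node b cs} {node b′ cs′} eq = cong₂ node (eq root) (nodeSets-ext λ i v → eq (child i v))

  nodeSets-ext : ∀ {p} {ts : Vec Tree p} {cs cs′ : All NodeSet ts} →
                 (∀ i v → marked (lookup⁺ cs i) v ≡ marked (lookup⁺ cs′ i) v) → cs ≡ cs′
  nodeSets-ext {cs = []}     {[]}       _  = refl
  nodeSets-ext {cs = c ∷ cs} {c′ ∷ cs′} eq = cong₂ _∷_ (nodeSet-ext (eq zero)) (nodeSets-ext (λ i → eq (suc i)))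

tabulate-markedAt : ∀ {t k} (c : ℕ → NodeSet t) (cs : Vec (NodeSet t) k) →
                    (∀ i v → marked (c i) v ≡ markedAt cs i v) → Vec.tabulate (c ∘ toℕ) ≡ cs
tabulate-markedAt c []       eq = refl
tabulate-markedAt c (d ∷ cs) eq = cong₂ _∷_ (nodeSet-ext (eq 0)) (tabulate-markedAt (c ∘ suc) cs (λ i → eq (suc i)))

cuts : ∀ {r} (b : CutTree r) → Vec (NodeSet (tree b)) r
cuts b = Vec.tabulate (cutAt b ∘ toℕ)

encode : ∀ {m} → CutTree m → Vec (Subset m) m → PaintedData m
encode {m} b μ = painted (tree b) m (cuts b) μ

encode-injective : ∀ {m} {b b′ : CutTree m} {μ μ′} → encode b μ ≡ encode b′ μ′ → b ≡ b′ × μ ≡ μ′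
encode-injective {b = b} {b′} eq with tree-injective b b′ (cong PaintedData.tree eq)
encode-injective refl | refl = refl , refl

-- The number of binary nodes, which is one less than the number of leaves; it is the n of an
-- n-tree.
size : ∀ {r} → CutTree r → ℕ
size leaf      = 0
size (cut b)   = size b
size (bin a b) = suc (size a + size b)

leaves-tree : ∀ {r} (b : CutTree r) → leaves (tree b) ≡ suc (size b)
leaves-tree leaf      = refl
leaves-tree (cut b)   = trans (+-identityʳ _) (leaves-tree b)
leaves-tree (bin a b) = trans
  (cong₂ _+_ (leaves-tree a) (trans (+-identityʳ _) (leaves-tree b)))
  (cong suc (+-suc (size a) (size b)))

encode-isBinaryPaintedTree : ∀ {m n} (b : CutTree m) {μ} → size b ≡ n → IsOrderedPartition μ →
                             IsBinaryPaintedTree m n (encode b μ)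
encode-isBinaryPaintedTree {m} b {μ} size≡n μ-partition = record
  { leaves≡1+n       = trans (leaves-tree b) (cong suc size≡n)
  ; areCuts          = λ i → subst IsCut (sym (lookup∘tabulate _ i)) (P.areCuts (toℕ i) (toℕ<n i))
  ; below            = linked-tabulate m (cutAt b) P.below
  ; unary⇒inCut      = λ v unary → inSomeCut⁺ (P.unary⇒inCut v unary)
  ; orderedPartition = μ-partition
  } , record
  { k≡m             = refl
  ; inCut⇒unary     = λ v (i , v∈) → P.inCut⇒unary (toℕ i) v (subst (v ∈ᴺ_) (lookup∘tabulate _ i) v∈)
  ; notInCut⇒binary = λ v v∉ → P.notInCut⇒binary v (λ i v∈ → v∉ (inSomeCut⁺ (i , v∈)))
  }
  where
  module P = IsBinaryPainting (isBinaryPainting b)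
  inSomeCut⁺ : ∀ {v} → (∃ λ i → v ∈ᴺ cutAt b i) → InSomeCut (encode b μ) v
  inSomeCut⁺ {v} (i , v∈) with m ≤? i
  ... | yes m≤i = ⊥-elim (cutAt-empty b i m≤i v v∈)
  ... | no m≰i  = fromℕ< i<m ,
    subst (v ∈ᴺ_) (sym (lookup∘tabulate _ (fromℕ< i<m)))
      (subst (λ j → v ∈ᴺ cutAt b j) (sym (toℕ-fromℕ< i<m)) v∈)
    where i<m = ≰⇒> m≰i

-- Together with `encode-isBinaryPaintedTree` this turns every question about binary painted trees
-- into one about pairs of a cut tree and an ordered partition.
decode : ∀ {m n 𝕋} → IsBinaryPaintedTree m n 𝕋 →
         ∃₂ λ b μ → size b ≡ n × IsOrderedPartition μ × 𝕋 ≡ encode b μ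
decode {m} {n} {painted t k cs μ} (isPainted , record { k≡m = refl ; inCut⇒unary = inCut⇒unary′ ; notInCut⇒binary = notInCut⇒binary′ })
  with decompose t (markedAt cs) record
    { areCuts         = λ i i<m → subst IsCutᴹ (markedAt-fromℕ< cs i<m) (areCuts (fromℕ< i<m))
    ; below           = below-markedAt below
    ; empty           = markedAt-empty cs
    ; unary⇒inCut     = λ v unary → let i , v∈ = unary⇒inCut v unary in
                          toℕ i , subst (v ∈ᴹ_) (markedAt-lookup cs i) v∈
    ; inCut⇒unary     = λ i v v∈ → inCut⇒unary′ v (inSomeCut⁺ i v∈)
    ; notInCut⇒binary = λ v v∉ → notInCut⇒binary′ v
                          (λ (i , v∈) → v∉ (toℕ i) (subst (v ∈ᴹ_) (markedAt-lookup cs i) v∈))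
    }
  where
  open IsPainted isPainted
  inSomeCut⁺ : ∀ i {v} → v ∈ᴹ markedAt cs i → InSomeCut (painted t m cs μ) v
  inSomeCut⁺ i {v} v∈ = fromℕ< i<m , subst (v ∈ᴹ_) (sym (markedAt-fromℕ< cs i<m)) v∈
    where i<m = ∈markedAt⇒< cs i v∈
... | b , refl , eq = b , μ , suc-injective (trans (sym (leaves-tree b)) (IsPainted.leaves≡1+n isPainted)) ,
  IsPainted.orderedPartition isPainted ,
  cong (λ cs → painted (tree b) m cs μ) (sym (tabulate-markedAt (cutAt b) cs eq))

-- Shadows

-- The first component of the shadow: the last subtree of a node is left out, so a unary node
-- contributes the empty tuple.
counts : ∀ {r} → CutTree r → List (List ℕ)
counts leaf      = []
counts (cut b)   = [] ∷ counts b
counts (bin a b) = (suc (size a) ∷ []) ∷ counts b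

leafCounts-rightBranch : ∀ {r} (b : CutTree r) → map leafCounts (rightBranch (tree b)) ≡ counts b
leafCounts-rightBranch leaf      = refl
leafCounts-rightBranch (cut b)   =
  cong ([] ∷_) (trans (sym (map-∘ (rightBranch (tree b)))) (leafCounts-rightBranch b))
leafCounts-rightBranch (bin a b) =
  cong₂ _∷_ (cong (_∷ []) (leaves-tree a)) (trans (sym (map-∘ (rightBranch (tree b)))) (leafCounts-rightBranch b))

labelAt : ∀ {m k} → Vec (Subset m) k → ℕ → Subset m
labelAt []       _       = ∅
labelAt (M ∷ Ms) zero    = M
labelAt (M ∷ Ms) (suc i) = labelAt Ms i

labelAt-injective : ∀ {m k} {μ μ′ : Vec (Subset m) k} → (∀ i → i < k → labelAt μ i ≡ labelAt μ′ i) → μ ≡ μ′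
labelAt-injective {μ = []}     {[]}       eq = refl
labelAt-injective {μ = M ∷ Ms} {M′ ∷ Ms′} eq =
  cong₂ _∷_ (eq 0 (s≤s z≤n)) (labelAt-injective λ i i<k → eq (suc i) (s≤s i<k))

-- `label` at a fixed node depends only on which cuts contain the node; `p` records these.
labelBy : ∀ {m k} → (ℕ → Bool) → Vec (Subset m) k → Subset m
labelBy p []       = ∅
labelBy p (M ∷ Ms) = if p 0 then M else labelBy (p ∘ suc) Ms

label-tabulate : ∀ {t m k} (c : ℕ → NodeSet t) (μ : Vec (Subset m) k) v →
                 label (Vec.tabulate (c ∘ toℕ)) μ v ≡ labelBy (λ i → marked (c i) v) μ
label-tabulate c []       v = refl
label-tabulate c (M ∷ Ms) v = cong (if marked (c 0) v then M else_) (label-tabulate (c ∘ suc) Ms v)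

labelBy-≡ᵇ : ∀ {m k} r (μ : Vec (Subset m) k) → labelBy (_≡ᵇ r) μ ≡ labelAt μ r
labelBy-≡ᵇ r       []       = refl
labelBy-≡ᵇ zero    (M ∷ Ms) = refl
labelBy-≡ᵇ (suc r) (M ∷ Ms) = labelBy-≡ᵇ r Ms

labelBy-false : ∀ {m k} (μ : Vec (Subset m) k) → labelBy (λ _ → false) μ ≡ ∅
labelBy-false []       = refl
labelBy-false (M ∷ Ms) = labelBy-false Ms

branchLabels : ∀ {r m} → CutTree r → (ℕ → Subset m) → List (Subset m)
branchLabels leaf        f = []
branchLabels (cut {r} b) f = f r ∷ branchLabels b f
branchLabels (bin a b)   f = ∅ ∷ branchLabels b f

-- The vector of labels may be longer than the number of cuts, because the
-- subtree below a cut has fewer cuts but is labelled by the same vector.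
labelBy-rightBranch : ∀ {r m k} (b : CutTree r) (μ : Vec (Subset m) k) →
  map (λ v → labelBy (λ i → marked (cutAt b i) v) μ) (rightBranch (tree b)) ≡ branchLabels b (labelAt μ)
labelBy-rightBranch leaf        μ = refl
labelBy-rightBranch (cut {r} b) μ =
  cong₂ _∷_ (labelBy-≡ᵇ r μ) (trans (sym (map-∘ (rightBranch (tree b)))) (labelBy-rightBranch b μ))
labelBy-rightBranch (bin a b)   μ =
  cong₂ _∷_ (labelBy-false μ) (trans (sym (map-∘ (rightBranch (tree b)))) (labelBy-rightBranch b μ))

shadow-encode : ∀ {m} (b : CutTree m) μ → Shadow (encode b μ) ≡ (counts b , branchLabels b (labelAt μ))
shadow-encode b μ = cong₂ _,_ (leafCounts-rightBranch b)
  (trans (map-cong (label-tabulate (cutAt b) μ) (rightBranch (tree b))) (labelBy-rightBranch b μ))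

-- The right branch meets every cut, so each of the r values occurs in the list, at a position fixed
-- by the tree.
branchLabels-injective : ∀ {r m} (b : CutTree r) {f f′ : ℕ → Subset m} →
                         branchLabels b f ≡ branchLabels b f′ → ∀ i → i < r → f i ≡ f′ i
branchLabels-injective leaf      eq i ()
branchLabels-injective (bin a b) eq = branchLabels-injective b (∷-injectiveʳ eq)
branchLabels-injective (cut b)   eq i i<1+r with m≤n⇒m<n∨m≡n (s≤s⁻¹ i<1+r)
... | inj₁ i<r  = branchLabels-injective b (∷-injectiveʳ eq) i i<r
... | inj₂ refl = ∷-injectiveˡ eq

-- The counts show which nodes of the branch are unary, and the cuts occur on it from the highest to
-- the lowest. Hence trees with equal counts and equal labels have equal shadows.
branchLabels-cong : ∀ {r m} (b b′ : CutTree r) {f : ℕ → Subset m} → counts b ≡ counts b′ →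
                    branchLabels b f ≡ branchLabels b′ f
branchLabels-cong leaf      leaf        eq = refl
branchLabels-cong (cut b)   (cut b′)    eq = cong (_ ∷_) (branchLabels-cong b b′ (∷-injectiveʳ eq))
branchLabels-cong (bin a b) (bin a′ b′) eq = cong (_ ∷_) (branchLabels-cong b b′ (∷-injectiveʳ eq))
branchLabels-cong leaf      (bin _ _)   ()
branchLabels-cong (cut _)   (bin _ _)   ()
branchLabels-cong (bin _ _) leaf        ()
branchLabels-cong (bin _ _) (cut _)     ()

-- Trees determined by their shadow

stem : ∀ r → CutTree r
stem zero    = leaf
stem (suc r) = cut (stem r)

cherry : CutTree 0
cherry = bin leaf leaf

size-stem : ∀ r → size (stem r) ≡ 0
size-stem zero    = refl
size-stem (suc r) = size-stem r

size≡0⇒stem : ∀ {r} (b : CutTree r) → size b ≡ 0 → b ≡ stem r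
size≡0⇒stem leaf    _  = refl
size≡0⇒stem (cut b) eq = cong cut (size≡0⇒stem b eq)

size≡1⇒cherry : (b : CutTree 0) → size b ≡ 1 → b ≡ cherry
size≡1⇒cherry (bin leaf leaf) _ = refl
size≡1⇒cherry (bin leaf (bin _ _)) ()
size≡1⇒cherry (bin (bin _ _) _) ()

-- The trees all of whose left subtrees hanging off the right branch are
-- determined by their numbers of leaves and of cuts.
data IsSingle : ∀ {r} → CutTree r → Set where
  leaf       : IsSingle leaf
  cut        : ∀ {r} {b : CutTree r} → IsSingle b → IsSingle (cut b)
  bin-stem   : ∀ {r} {b : CutTree r} → IsSingle b → IsSingle (bin (stem r) b)
  bin-cherry : ∀ {b} → IsSingle b → IsSingle (bin cherry b)

-- The counts give the size of each left subtree. Size 0 forces a stem; size 1 without cuts forces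
-- the cherry.
counts-injective : ∀ {r} {b b′ : CutTree r} → IsSingle b → counts b′ ≡ counts b → b′ ≡ b
counts-injective {b′ = leaf}      leaf           eq = refl
counts-injective {b′ = cut b′}    (cut s)        eq = cong cut (counts-injective s (∷-injectiveʳ eq))
counts-injective {r} {b′ = bin a′ b′} (bin-stem s)   eq = cong₂ bin
  (size≡0⇒stem a′ (trans (suc-injective (∷-injectiveˡ (∷-injectiveˡ eq))) (size-stem r)))
  (counts-injective s (∷-injectiveʳ eq))
counts-injective {b′ = bin a′ b′} (bin-cherry s) eq = cong₂ bin
  (size≡1⇒cherry a′ (suc-injective (∷-injectiveˡ (∷-injectiveˡ eq))))
  (counts-injective s (∷-injectiveʳ eq))
counts-injective {b′ = bin _ _}   leaf           ()
counts-injective {b′ = bin _ _}   (cut _)        ()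
counts-injective {b′ = leaf}      (bin-stem _)   ()
counts-injective {b′ = cut _}     (bin-stem _)   ()
counts-injective {b′ = leaf}      (bin-cherry _) ()

-- The trees that are alone with their size and number of cuts.
data IsRigid : ∀ {r} → CutTree r → Set where
  rigid-stem   : ∀ {r} → IsRigid (stem r)
  rigid-cherry : IsRigid cherry

-- A comb, serving as a specimen for any prescribed number of cuts and size.
chain : ∀ r → ℕ → CutTree r
chain r zero    = stem r
chain r (suc n) = bin (stem r) (chain r n)

size-chain : ∀ r (n : ℕ) → size (chain r n) ≡ n
size-chain r zero    = size-stem r
size-chain r (suc n) = cong suc (cong₂ _+_ (size-stem r) (size-chain r n))

rigidOrRival : ∀ {r} (b : CutTree r) → IsRigid b ⊎ ∃ λ b′ → size b′ ≡ size b × b′ ≢ b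
rigidOrRival leaf = inj₁ (rigid-stem {zero})
rigidOrRival (cut b) with rigidOrRival b
... | inj₁ rigid-stem                = inj₁ (rigid-stem {suc _})
-- A cut above a cherry can be pushed below its binary node.
... | inj₁ rigid-cherry              = inj₂ (bin (cut leaf) (cut leaf) , refl , λ ())
... | inj₂ (b′ , size≡ , b′≢b) = inj₂ (cut b′ , size≡ , λ { refl → b′≢b refl })
-- A tree with at least one cut and a binary root has a rival with a unary root.
rigidOrRival {suc r} (bin a b) =
  inj₂ (cut (chain r (size (bin a b))) , size-chain r (size (bin a b)) , λ ())
rigidOrRival {zero} (bin leaf leaf)      = inj₁ rigid-cherry
-- Without cuts, three or more leaves allow a rotation at the root.
rigidOrRival {zero} (bin leaf (bin c d)) = inj₂ (bin (bin leaf c) d , refl , λ ())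
rigidOrRival {zero} (bin (bin c d) b)    = inj₂ (bin c (bin d b) ,
  cong suc (trans (+-suc (size c) _) (cong suc (sym (+-assoc (size c) (size d) (size b))))) ,
  -- The rotation makes the left subtree strictly smaller.
  λ eq → m≢1+m+n (size c) (cong (size ∘ leftSubtree) eq))
  where
  leftSubtree : CutTree 0 → CutTree 0
  leftSubtree leaf      = leaf
  leftSubtree (bin a _) = a

-- The shadow sees only the size of a left subtree, so a rival of a left subtree, or of the rest of
-- the branch, gives a rival of the whole tree.
singleOrRival : ∀ {r} (b : CutTree r) → IsSingle b ⊎ ∃ λ b′ → size b′ ≡ size b × counts b′ ≡ counts b × b′ ≢ b
singleOrRival leaf = inj₁ leaf
singleOrRival (cut b) with singleOrRival b
... | inj₁ s                             = inj₁ (cut s)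
... | inj₂ (b′ , size≡ , counts≡ , b′≢b) =
  inj₂ (cut b′ , size≡ , cong ([] ∷_) counts≡ , λ { refl → b′≢b refl })
singleOrRival (bin a b) with singleOrRival b | rigidOrRival a
... | inj₁ s | inj₁ rigid-stem   = inj₁ (bin-stem s)
... | inj₁ s | inj₁ rigid-cherry = inj₁ (bin-cherry s)
... | inj₁ _ | inj₂ (a′ , size≡ , a′≢a) =
  inj₂ (bin a′ b , cong (λ k → suc (k + size b)) size≡ , cong (λ k → (suc k ∷ []) ∷ counts b) size≡ ,
        λ { refl → a′≢a refl })
... | inj₂ (b′ , size≡ , counts≡ , b′≢b) | _ =
  inj₂ (bin a b′ , cong (λ k → suc (size a + k)) size≡ , cong (_ ∷_) counts≡ , λ { refl → b′≢b refl })

-- Enumeration of the single trees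

-- The split is on the topmost node. A cherry can hang only where no cut remains, and it uses up two
-- units of size; this produces the Fibonacci recursion at r = 0.
singles : ∀ r → ℕ → List (CutTree r)
singles zero    zero          = leaf ∷ []
singles zero    (suc zero)    = map (bin leaf) (singles zero zero)
singles zero    (suc (suc n)) = map (bin leaf) (singles zero (suc n)) ++ map (bin cherry) (singles zero n)
singles (suc r) zero          = map cut (singles r zero)
singles (suc r) (suc n)       = map cut (singles r (suc n)) ++ map (bin (stem (suc r))) (singles (suc r) n)

singles-complete : ∀ {r n} {b : CutTree r} → IsSingle b → size b ≡ n → b ∈ singles r n
singles-complete leaf refl = here refl
singles-complete {n = zero}  (cut s) eq = ∈-map⁺ cut (singles-complete s eq)
singles-complete {n = suc n} (cut s) eq = ∈-++⁺ˡ (∈-map⁺ cut (singles-complete s eq))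
singles-complete {zero}  {suc zero}    (bin-stem s) eq = ∈-map⁺ (bin leaf) (singles-complete s (suc-injective eq))
singles-complete {zero}  {suc (suc n)} (bin-stem s) eq =
  ∈-++⁺ˡ (∈-map⁺ (bin leaf) (singles-complete s (suc-injective eq)))
singles-complete {suc r} {suc n} (bin-stem {b = b} s) eq =
  ∈-++⁺ʳ (map cut (singles r (suc n))) (∈-map⁺ (bin (stem (suc r))) (singles-complete s
    (trans (cong (_+ size b) (sym (size-stem r))) (suc-injective eq))))
singles-complete {n = suc (suc n)} (bin-cherry s) eq =
  ∈-++⁺ʳ (map (bin leaf) (singles zero (suc n)))
    (∈-map⁺ (bin cherry) (singles-complete s (suc-injective (suc-injective eq))))

singles-sound : ∀ r n {b} → b ∈ singles r n → IsSingle b × size b ≡ n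
singles-sound zero zero (here refl) = leaf , refl
singles-sound zero (suc zero) b∈ with ∈-map⁻ (bin leaf) b∈
... | _ , c∈ , refl = let s , eq = singles-sound zero zero c∈ in bin-stem s , cong suc eq
singles-sound zero (suc (suc n)) b∈ with ∈-++⁻ (map (bin leaf) (singles zero (suc n))) b∈
singles-sound zero (suc (suc n)) b∈ | inj₁ b∈ˡ with ∈-map⁻ (bin leaf) b∈ˡ
... | _ , c∈ , refl = let s , eq = singles-sound zero (suc n) c∈ in bin-stem s , cong suc eq
singles-sound zero (suc (suc n)) b∈ | inj₂ b∈ʳ with ∈-map⁻ (bin cherry) b∈ʳ
... | _ , c∈ , refl = let s , eq = singles-sound zero n c∈ in bin-cherry s , cong (λ k → suc (suc k)) eq
singles-sound (suc r) zero b∈ with ∈-map⁻ cut b∈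
... | _ , c∈ , refl = let s , eq = singles-sound r zero c∈ in cut s , eq
singles-sound (suc r) (suc n) b∈ with ∈-++⁻ (map cut (singles r (suc n))) b∈
singles-sound (suc r) (suc n) b∈ | inj₁ b∈ˡ with ∈-map⁻ cut b∈ˡ
... | _ , c∈ , refl = let s , eq = singles-sound r (suc n) c∈ in cut s , eq
singles-sound (suc r) (suc n) b∈ | inj₂ b∈ʳ with ∈-map⁻ (bin (stem (suc r))) b∈ʳ
... | _ , c∈ , refl = let s , eq = singles-sound (suc r) n c∈ in
  bin-stem s , cong suc (cong₂ _+_ (size-stem r) eq)

map-disjoint : ∀ {A B C : Set} {f : A → C} {g : B → C} → (∀ x y → f x ≢ g y) →
               ∀ xs ys → Disjoint (map f xs) (map g ys)
map-disjoint f≢g _ _ (z∈ , z∈′) with ∈-map⁻ _ z∈ | ∈-map⁻ _ z∈′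
... | x , _ , refl | y , _ , eq = f≢g x y eq

singles-unique : ∀ r n → Unique (singles r n)
singles-unique zero    zero          = [] ∷ []
singles-unique zero    (suc zero)    = Unique.map⁺ {f = bin leaf} (λ { refl → refl }) (singles-unique zero zero)
singles-unique zero    (suc (suc n)) = Unique.++⁺
  (Unique.map⁺ (λ { refl → refl }) (singles-unique zero (suc n)))
  (Unique.map⁺ (λ { refl → refl }) (singles-unique zero n))
  (map-disjoint (λ _ _ ()) (singles zero (suc n)) (singles zero n))
singles-unique (suc r) zero          = Unique.map⁺ (λ { refl → refl }) (singles-unique r zero)
singles-unique (suc r) (suc n)       = Unique.++⁺
  (Unique.map⁺ (λ { refl → refl }) (singles-unique r (suc n)))
  (Unique.map⁺ (λ { refl → refl }) (singles-unique (suc r) n))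
  (map-disjoint (λ _ _ ()) (singles r (suc n)) (singles (suc r) n))

-- Counting

-- The number of multisets of size k on r elements. For r = 0 truncated subtraction gives 1 at k = 0
-- and 0 at larger k, which is the stated convention for m = 0.
multichoose : ℕ → ℕ → ℕ
multichoose r k = (r + k ∸ 1) C k

multichoose-suc : ∀ r k → multichoose (suc r) (suc k) ≡ multichoose r (suc k) + multichoose (suc r) k
multichoose-suc r k rewrite +-suc r k =
  trans (sym (nCk+nC[k+1]≡[n+1]C[k+1] (r + k) k)) (+-comm ((r + k) C k) ((r + k) C suc k))

sum-zero : ∀ n {f : ℕ → ℕ} → (∀ k → f k ≡ 0) → sum (applyUpTo f n) ≡ 0
sum-zero zero    f≡0 = refl
sum-zero (suc n) f≡0 = cong₂ _+_ (f≡0 0) (sum-zero n (f≡0 ∘ suc))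

sum-+ : ∀ n {f g h : ℕ → ℕ} → (∀ k → f k ≡ g k + h k) →
        sum (applyUpTo f n) ≡ sum (applyUpTo g n) + sum (applyUpTo h n)
sum-+ zero    f≡g+h = refl
sum-+ (suc n) {f} {g} {h} f≡g+h = trans
  (cong₂ _+_ (f≡g+h 0) (sum-+ n (f≡g+h ∘ suc)))
  (solve 4 (λ a b c d → (a :+ b) :+ (c :+ d) := (a :+ c) :+ (b :+ d)) refl
    (g 0) (h 0) (sum (applyUpTo (g ∘ suc) n)) (sum (applyUpTo (h ∘ suc) n)))

term : ℕ → ℕ → ℕ → ℕ
term r n k = multichoose r k * fib (n ∸ k + 1)

singlesCount : ℕ → ℕ → ℕ
singlesCount r n = sum (applyUpTo (term r n) (suc n))

-- Only the term k = 0 survives: there is no nonempty multiset on zero elements.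
singlesCount-zero : ∀ n → singlesCount 0 n ≡ fib (n + 1)
singlesCount-zero n = trans
  (cong₂ _+_ (*-identityˡ (fib (n + 1))) (sum-zero n λ k → cong (_* fib (n ∸ suc k + 1)) (k>n⇒nCk≡0 (n<1+n k))))
  (+-identityʳ _)

singlesCount-suc : ∀ r n → singlesCount (suc r) (suc n) ≡ singlesCount r (suc n) + singlesCount (suc r) n
singlesCount-suc r n = trans
  -- Pascal's rule is applied for k at least 1, with the index shifted by one; the terms at k = 0
  -- for r and `suc r` agree by computation.
  (cong (term (suc r) (suc n) 0 +_) (sum-+ (suc n) {g = term r (suc n) ∘ suc} {term (suc r) n} λ k →
    trans (cong (_* fib (n ∸ k + 1)) (multichoose-suc r k))
          (*-distribʳ-+ (fib (n ∸ k + 1)) (multichoose r (suc k)) (multichoose (suc r) k))))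
  (sym (+-assoc (term r (suc n) 0) (sum (applyUpTo (term r (suc n) ∘ suc) (suc n))) (singlesCount (suc r) n)))

length-singles : ∀ r n → length (singles r n) ≡ singlesCount r n
length-singles zero    n             = trans (fibonacci n) (sym (singlesCount-zero n))
  where
  fibonacci : ∀ n → length (singles 0 n) ≡ fib (n + 1)
  fibonacci zero          = refl
  fibonacci (suc zero)    = refl
  fibonacci (suc (suc n)) = trans (length-++ (map (bin leaf) (singles 0 (suc n))))
    (cong₂ _+_ (trans (length-map _ (singles 0 (suc n))) (fibonacci (suc n)))
               (trans (length-map _ (singles 0 n)) (fibonacci n)))
length-singles (suc r) zero          = trans (length-map _ (singles r zero)) (length-singles r zero)
length-singles (suc r) (suc n)       = trans
  (trans (length-++ (map cut (singles r (suc n))))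
    (cong₂ _+_ (trans (length-map _ (singles r (suc n))) (length-singles r (suc n)))
               (trans (length-map _ (singles (suc r) n)) (length-singles (suc r) n))))
  (sym (singlesCount-suc r n))

length-cartesianProductWith : ∀ {A B C : Set} (f : A → B → C) xs ys →
                              length (cartesianProductWith f xs ys) ≡ length xs * length ys
length-cartesianProductWith f []       ys = refl
length-cartesianProductWith f (x ∷ xs) ys = trans (length-++ (map (f x) ys))
  (cong₂ _+_ (length-map (f x) ys) (length-cartesianProductWith f xs ys))

-- Ordered partitions into singletons

lookup-ext : ∀ {A : Set} {k} {xs ys : Vec A k} → (∀ i → Vec.lookup xs i ≡ Vec.lookup ys i) → xs ≡ ys
lookup-ext {xs = xs} {ys} eq =
  trans (sym (tabulate∘lookup xs)) (trans (tabulate-cong eq) (tabulate∘lookup ys))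

map-injective : ∀ {A B : Set} {f : A → B} → (∀ {x y} → f x ≡ f y → x ≡ y) →
                ∀ {k} {xs ys : Vec A k} → Vec.map f xs ≡ Vec.map f ys → xs ≡ ys
map-injective {f = f} f-inj {xs = xs} {ys} eq = lookup-ext λ i → f-inj
  (trans (sym (lookup-map i f xs)) (trans (cong (λ zs → Vec.lookup zs i) eq) (lookup-map i f ys)))

-- Stated as injectivity; surjectivity is read off the enumeration in `permutation-surjective`.
IsPermutation : ∀ {m} → Vec (Fin m) m → Set
IsPermutation σ = ∀ i j → Vec.lookup σ i ≡ Vec.lookup σ j → i ≡ j

-- The first value is chosen freely, and `punchIn x` relabels a permutation of the smaller set by
-- the values other than x.
extend : ∀ {m} → Fin (suc m) → Vec (Fin m) m → Vec (Fin (suc m)) (suc m)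
extend x σ = x ∷ Vec.map (punchIn x) σ

permutations : ∀ m → List (Vec (Fin m) m)
permutations zero    = [] ∷ []
permutations (suc m) = cartesianProductWith extend (allFin (suc m)) (permutations m)

length-permutations : ∀ m → length (permutations m) ≡ m !
length-permutations zero    = refl
length-permutations (suc m) = trans (length-cartesianProductWith extend (allFin (suc m)) (permutations m))
  (cong₂ _*_ (length-tabulate {n = suc m} id) (length-permutations m))

permutations-unique : ∀ m → Unique (permutations m)
permutations-unique zero    = [] ∷ []
permutations-unique (suc m) =
  Unique.cartesianProductWith⁺ extend extend-injective (Unique.allFin⁺ (suc m)) (permutations-unique m)
  where
  extend-injective : ∀ {x y σ τ} → extend x σ ≡ extend y τ → x ≡ y × σ ≡ τ
  extend-injective {x} eq with Vec.∷-injective eq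
  ... | refl , eq′ = refl , map-injective (punchIn-injective x _ _) eq′

permutations-sound : ∀ m {σ} → σ ∈ permutations m → IsPermutation σ
permutations-sound (suc m) σ∈ with ∈-cartesianProductWith⁻ extend (allFin (suc m)) (permutations m) σ∈
... | x , τ , _ , τ∈ , refl = λ where
  zero    zero    _  → refl
  zero    (suc j) eq → ⊥-elim (punchInᵢ≢i x _ (trans (sym (lookup-map j (punchIn x) τ)) (sym eq)))
  (suc i) zero    eq → ⊥-elim (punchInᵢ≢i x _ (trans (sym (lookup-map i (punchIn x) τ)) eq))
  (suc i) (suc j) eq → cong suc (permutations-sound m τ∈ i j (punchIn-injective x _ _
    (trans (sym (lookup-map i (punchIn x) τ)) (trans eq (lookup-map j (punchIn x) τ)))))

-- By injectivity the tail avoids the head x, so `punchOut` carries it back to a permutation of the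
-- smaller set.
permutations-complete : ∀ {m} {σ : Vec (Fin m) m} → IsPermutation σ → σ ∈ permutations m
permutations-complete {zero}  {[]}    _   = here refl
permutations-complete {suc m} {x ∷ σ} inj =
  subst (_∈ permutations (suc m)) (cong (x ∷_) (sym σ≡))
    (∈-cartesianProductWith⁺ extend (∈-allFin x) (permutations-complete τ-inj))
  where
  x≢ : ∀ i → x ≢ Vec.lookup σ i
  x≢ i eq with inj zero (suc i) eq
  ... | ()
  τ : Vec (Fin m) m
  τ = Vec.tabulate (λ i → punchOut (x≢ i))
  τ-inj : IsPermutation τ
  τ-inj i j eq = Fin.suc-injective (inj (suc i) (suc j) (punchOut-injective (x≢ i) (x≢ j)
    (trans (sym (lookup∘tabulate _ i)) (trans eq (lookup∘tabulate _ j)))))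
  σ≡ : σ ≡ Vec.map (punchIn x) τ
  σ≡ = lookup-ext λ i → sym (trans (lookup-map i (punchIn x) τ)
    (trans (cong (punchIn x) (lookup∘tabulate _ i)) (punchIn-punchOut (x≢ i))))

permutation-surjective : ∀ m {σ : Vec (Fin m) m} → σ ∈ permutations m → ∀ y → ∃ λ i → Vec.lookup σ i ≡ y
permutation-surjective (suc m) σ∈ y with ∈-cartesianProductWith⁻ extend (allFin (suc m)) (permutations m) σ∈
... | x , τ , _ , τ∈ , refl with x ≟ y
...   | yes x≡y = zero , x≡y
...   | no  x≢y with permutation-surjective m τ∈ (punchOut x≢y)
...     | i , eq = suc i , trans (lookup-map i (punchIn x) τ) (trans (cong (punchIn x) eq) (punchIn-punchOut x≢y))

singletons : ∀ {m} → Vec (Fin m) m → Vec (Subset m) m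
singletons = Vec.map ⁅_⁆

orderings : ∀ m → List (Vec (Subset m) m)
orderings m = map singletons (permutations m)

orderings-unique : ∀ m → Unique (orderings m)
orderings-unique m = Unique.map⁺ (map-injective ⁅⁆-injective) (permutations-unique m)
  where
  ⁅⁆-injective : ∀ {x y : Fin m} → ⁅ x ⁆ ≡ ⁅ y ⁆ → x ≡ y
  ⁅⁆-injective {x} {y} eq = x∈⁅y⁆⇒x≡y y (subst (x ∈ˢ_) eq (x∈⁅x⁆ x))

orderings-sound : ∀ m {μ} → μ ∈ orderings m → IsOrderedPartition μ
orderings-sound m μ∈ with ∈-map⁻ singletons μ∈
... | σ , σ∈ , refl = (λ i → Vec.lookup σ i , ∈singletons⁺ refl) , λ x →
  let i , σᵢ≡x = permutation-surjective m σ∈ x in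
  i , ∈singletons⁺ (sym σᵢ≡x) ,
  λ {j} x∈ → permutations-sound m σ∈ i j (trans σᵢ≡x (∈singletons⁻ x∈))
  where
  ∈singletons⁺ : ∀ {x i} → x ≡ Vec.lookup σ i → x ∈ˢ Vec.lookup (singletons σ) i
  ∈singletons⁺ {x} {i} refl = subst (x ∈ˢ_) (sym (lookup-map i ⁅_⁆ σ)) (x∈⁅x⁆ x)
  ∈singletons⁻ : ∀ {x i} → x ∈ˢ Vec.lookup (singletons σ) i → x ≡ Vec.lookup σ i
  ∈singletons⁻ {x} {i} x∈ = x∈⁅y⁆⇒x≡y _ (subst (x ∈ˢ_) (lookup-map i ⁅_⁆ σ) x∈)

-- One element is chosen from each of the m parts. Disjointness makes the choice injective, hence
-- onto, so an element of a part is the chosen one of some part, and by disjointness of the same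
-- part.
orderings-complete : ∀ {m} {μ : Vec (Subset m) m} → IsOrderedPartition μ → μ ∈ orderings m
orderings-complete {m} {μ} (nonempty , part) =
  subst (_∈ orderings m) (sym μ≡) (∈-map⁺ singletons σ∈)
  where
  part-unique : ∀ {x i j} → x ∈ˢ Vec.lookup μ i → x ∈ˢ Vec.lookup μ j → i ≡ j
  part-unique {x} x∈ᵢ x∈ⱼ = let _ , _ , unique = part x in trans (sym (unique x∈ᵢ)) (unique x∈ⱼ)
  σ : Vec (Fin m) m
  σ = Vec.tabulate (proj₁ ∘ nonempty)
  σᵢ∈μᵢ : ∀ i → Vec.lookup σ i ∈ˢ Vec.lookup μ i
  σᵢ∈μᵢ i = subst (_∈ˢ Vec.lookup μ i) (sym (lookup∘tabulate _ i)) (proj₂ (nonempty i))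
  σ∈ : σ ∈ permutations m
  σ∈ = permutations-complete λ i j eq →
    part-unique (subst (_∈ˢ Vec.lookup μ i) eq (σᵢ∈μᵢ i)) (σᵢ∈μᵢ j)
  μᵢ⊆ : ∀ i {x} → x ∈ˢ Vec.lookup μ i → x ∈ˢ ⁅ Vec.lookup σ i ⁆
  μᵢ⊆ i {x} x∈ with permutation-surjective m σ∈ x
  ... | j , refl with part-unique x∈ (σᵢ∈μᵢ j)
  ...   | refl = x∈⁅x⁆ _
  ⊆μᵢ : ∀ i {x} → x ∈ˢ ⁅ Vec.lookup σ i ⁆ → x ∈ˢ Vec.lookup μ i
  ⊆μᵢ i x∈ = subst (_∈ˢ Vec.lookup μ i) (sym (x∈⁅y⁆⇒x≡y _ x∈)) (σᵢ∈μᵢ i)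
  μ≡ : μ ≡ singletons σ
  μ≡ = lookup-ext λ i → trans (⊆-antisym (μᵢ⊆ i) (⊆μᵢ i)) (sym (lookup-map i ⁅_⁆ σ))

-- Singletons as labelled single trees

-- The two components of the shadow act in turn: the counts recover the cut tree, then the labels
-- along its right branch recover the partition.
encode-isSingleton : ∀ {m n} {b : CutTree m} {μ} → IsSingle b → size b ≡ n → IsOrderedPartition μ →
                     IsSingleton m n (encode b μ)
encode-isSingleton {m} {n} {b} {μ} s size≡n μ-part =
  encode-isBinaryPaintedTree b size≡n μ-part , unique
  where
  unique : ∀ 𝕋′ → IsBinaryPaintedTree m n 𝕋′ → Shadow 𝕋′ ≡ Shadow (encode b μ) → 𝕋′ ≡ encode b μ
  unique 𝕋′ isBPT shadow≡ with decode isBPT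
  ... | b′ , μ′ , _ , _ , refl
    with trans (sym (shadow-encode b′ μ′)) (trans shadow≡ (shadow-encode b μ))
  ...   | eq with counts-injective s (cong proj₁ eq)
  ...     | refl = cong (encode b) (labelAt-injective (branchLabels-injective b (cong proj₂ eq)))

-- A rival of the cut tree, given the same labels, would be a second painted tree with this shadow.
isSingleton⇒isSingle : ∀ {m n} {b : CutTree m} {μ} → size b ≡ n → IsOrderedPartition μ →
                       IsSingleton m n (encode b μ) → IsSingle b
isSingleton⇒isSingle {b = b} {μ} size≡n μ-part (_ , unique) with singleOrRival b
... | inj₁ s = s
... | inj₂ (b′ , size≡ , counts≡ , b′≢b) = ⊥-elim (b′≢b (proj₁ (encode-injective
  (unique (encode b′ μ) (encode-isBinaryPaintedTree b′ (trans size≡ size≡n) μ-part)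
    (trans (shadow-encode b′ μ)
      (trans (cong₂ _,_ counts≡ (branchLabels-cong b′ b counts≡)) (sym (shadow-encode b μ))))))))

corollary45 : (m n : ℕ) →
    HasCardinality (IsSingleton m n)
    (m ! * sum (map (λ k → ((m + k ∸ 1) C k) * fib (n ∸ k + 1)) (upTo (suc n))))
corollary45 m n = 𝕋s , 𝕋s-unique , (λ 𝕋 → mk⇔ (sound 𝕋) (complete 𝕋)) , count
  where
  𝕋s : List (PaintedData m)
  -- Shape and labelling are chosen independently, whence the product in the formula.
  𝕋s = cartesianProductWith encode (singles m n) (orderings m)
  𝕋s-unique : Unique 𝕋s
  𝕋s-unique = Unique.cartesianProductWith⁺ encode encode-injective (singles-unique m n) (orderings-unique m)
  sound : ∀ 𝕋 → 𝕋 ∈ 𝕋s → IsSingleton m n 𝕋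
  sound 𝕋 𝕋∈ with ∈-cartesianProductWith⁻ encode (singles m n) (orderings m) 𝕋∈
  ... | b , μ , b∈ , μ∈ , refl = let s , size≡n = singles-sound m n b∈ in
    encode-isSingleton s size≡n (orderings-sound m μ∈)
  complete : ∀ 𝕋 → IsSingleton m n 𝕋 → 𝕋 ∈ 𝕋s
  complete 𝕋 isSingleton with decode (proj₁ isSingleton)
  ... | b , μ , size≡n , μ-part , refl = ∈-cartesianProductWith⁺ encode
    (singles-complete (isSingleton⇒isSingle size≡n μ-part isSingleton) size≡n) (orderings-complete μ-part)
  count : length 𝕋s ≡ m ! * sum (map (term m n) (upTo (suc n)))
  count = trans (length-cartesianProductWith encode (singles m n) (orderings m))
    (trans (*-comm (length (singles m n)) (length (orderings m)))
      (cong₂ _*_ (trans (length-map singletons (permutations m)) (length-permutations m))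
                 (trans (length-singles m n) (cong sum (sym (map-upTo (term m n) (suc n)))))))
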